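{- There is an algorithm that takes as input a unary FA-presentation $(a^*,\phi)$ of an algebra $\mathcal{S}$ (with finitely many operations, given by finite automata recognizing the relations of the presentation), a finite set $X\subseteq a^*$, and a word $w\in a^*$, and decides whether $w\phi$ lies in the subalgebra of $\mathcal{S}$ generated by $X\phi$.
   Context: For words $w_1,\dots,w_n$ over a finite alphabet $A$, $\mathrm{conv}(w_1,\dots,w_n)$ is the word over $(A\cup\{\$\})^n$ ($\$$ a new symbol) whose $j$-th letter is the tuple of $j$-th letters of the $w_i$, shorter words padded at the end with $\$$. A relation $R\subseteq (A^*)^n$ is regular if $\{\mathrm{conv}(w_1,\dots,w_n):(w_1,\dots,w_n)\in R\}$ is regular. An algebra is regarded as a relational structure by replacing each $k$-ary operation $f$ by its graph $\{(x_1,\dots,x_k,(x_1,\dots,x_k)f)\}$. An FA-presentation of a relational structure $\mathcal{S}=(S,R_1,\dots,R_n)$ is a pair $(L,\phi)$ with $L$ a regular language and $\phi:L\to S$ surjective such that for each $R\in\{=,R_1,\dots,R_n\}$ of arity $r$, $\{(w_1,\dots,w_r)\in L^r: R(w_1\phi,\dots,w_r\phi)\}$ is regular; it is unary if $L$ is over a one-letter alphabet. -}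

module Defs where

open import Data.Nat using (ℕ; zero; suc; _⊔_; _<ᵇ_)
open import Data.Bool using (Bool; true; false)
open import Data.Fin using (Fin)
open import Data.List using (List; map; upTo; foldl)
open import Data.List.Relation.Unary.Any using (Any)
open import Data.Vec using (Vec; lookup; tabulate; foldr; _∷ʳ_)
import Data.Vec as V
open import Data.Product using (∃; _×_)
open import Relation.Binary.PropositionalEquality using (_≡_)

-- The one-letter alphabet {a}: the word a^n is identified with n : ℕ.
-- A letter of (A ∪ {$})^r is a Vec Bool r  (true = a, false = $).
Letter : ℕ → Set
Letter r = Vec Bool r

-- conv(a^{n_1},…,a^{n_r}) : length max n_i, the j-th letter has
-- component i equal to a iff j < n_i (otherwise the padding symbol $).
maxV : ∀ {r} → Vec ℕ r → ℕ
maxV = foldr _ _⊔_ 0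

conv : ∀ {r} → Vec ℕ r → List (Letter r)
conv ns = map (λ j → tabulate (λ i → j <ᵇ lookup ns i)) (upTo (maxV ns))

record DFA (r : ℕ) : Set where
  field
    nStates : ℕ
    start   : Fin nStates
    δ       : Fin nStates → Letter r → Fin nStates
    accept  : Fin nStates → Bool

run : ∀ {r} (D : DFA r) → List (Letter r) → Fin (DFA.nStates D)
run D = foldl (DFA.δ D) (DFA.start D)

Accepts : ∀ {r} → DFA r → List (Letter r) → Set
Accepts D w = DFA.accept D (run D w) ≡ true

record Algebra (m : ℕ) (ar : Fin m → ℕ) : Set₁ where
  field
    Carrier : Set
    op      : (i : Fin m) → Vec Carrier (ar i) → Carrier

data Generated {m ar} (S : Algebra m ar) (Y : Algebra.Carrier S → Set)
       : Algebra.Carrier S → Set where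
  gen : ∀ {s} → Y s → Generated S Y s
  app : (i : Fin m) (xs : Vec (Algebra.Carrier S) (ar i)) →
        ((j : Fin (ar i)) → Generated S Y (lookup xs j)) →
        Generated S Y (Algebra.op S i xs)

record IsUnaryFAPresentation {m ar} (S : Algebra m ar)
         (φ : ℕ → Algebra.Carrier S)
         (Deq : DFA 2) (Dop : (i : Fin m) → DFA (suc (ar i))) : Set where
  field
    surjective : ∀ s → ∃ λ n → φ n ≡ s
    eqCorrect  : ∀ u v →
      (Accepts Deq (conv (u V.∷ v V.∷ V.[])) → φ u ≡ φ v) × (φ u ≡ φ v → Accepts Deq (conv (u V.∷ v V.∷ V.[])))
    opCorrect  : ∀ i (us : Vec ℕ (ar i)) v →
      (Accepts (Dop i) (conv (us ∷ʳ v)) → Algebra.op S i (V.map φ us) ≡ φ v)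
      × (Algebra.op S i (V.map φ us) ≡ φ v → Accepts (Dop i) (conv (us ∷ʳ v)))

Image : ∀ {m ar} (S : Algebra m ar) → (ℕ → Algebra.Carrier S) → List ℕ →
        Algebra.Carrier S → Set
Image S φ X s = Any (λ x → φ x ≡ s) X

-- Adding the equality relation to the graphs of the operations, the words
-- denoting generated elements form the least P ⊆ ℕ that contains X and is
-- closed under finitely many automatic Horn rules P u₁, …, P uₖ ⇒ P v.
-- Reading P from left to right, the set of (rule, automaton state, components
-- still alive) reachable by partial violations of a rule is updated by a
-- fixed function of the next bit of P, and it ranges over a finite set of
-- size K. Saturate X below n₀ + K + 1, where n₀ exceeds w and X. If w is not
-- produced, two of these sets at positions ≥ n₀ coincide, and repeating P
-- periodically between them gives a closed set on all of ℕ that contains X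
-- but not w.
module Submission where

open import Defs
open import Data.Nat using (ℕ; zero; suc; _+_; _^_; _≤_; _<_; _<ᵇ_; z≤n; s≤s; s≤s⁻¹; _≟_)
open import Data.Nat.Properties
open import Data.Bool using (Bool; true; false; not; if_then_else_)
open import Data.Bool.Properties using (T-≡; ¬-not)
import Data.Bool.Properties as Bool
open import Data.Fin using (Fin; zero; suc; toℕ; fromℕ<; funToFin; finToFun)
open import Data.Fin.Properties using (any?; all?; pigeonhole; finToFun-funToFin; toℕ<n; toℕ-fromℕ<)
import Data.Fin.Properties as Fin
open import Data.Fin.Subset.Properties using (anySubset?)
open import Data.List using (List; []; _∷_; map; upTo; length; filter; concatMap; cartesianProduct; allFin; _++_)
import Data.List as List
open import Data.List.Properties using (upTo-∷ʳ; map-++; foldl-∷ʳ; filter-notAll)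
open import Data.List.Extrema.Nat using (max; ⊥≤max; xs≤max)
open import Data.List.Membership.Propositional using (_∈_; _∉_; lose; find)
open import Data.List.Membership.Propositional.Properties
  using (∈-filter⁺; ∈-filter⁻; ∈-upTo⁺; ∈-concatMap⁺; ∈-cartesianProduct⁺; ∈-allFin; ∈-map⁺; ∈-++⁺ˡ; ∈-++⁺ʳ)
open import Data.List.Membership.DecPropositional _≟_ using (_∈?_)
open import Data.List.Relation.Unary.Any using (here; index)
import Data.List.Relation.Unary.Any as Any
import Data.List.Relation.Unary.Any.Properties as Any
import Data.List.Relation.Unary.All as All
open import Data.Vec using (Vec; []; _∷_; lookup; tabulate; replicate; _∷ʳ_; initLast)
import Data.Vec as Vec
open import Data.Vec.Properties
  using (lookup∘tabulate; tabulate∘lookup; tabulate-cong; lookup-replicate; lookup-map; ≡-dec)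
open import Data.Product using (Σ; ∃; ∃₂; _×_; _,_; proj₁; proj₂)
open import Data.Sum using (_⊎_; inj₁; inj₂)
open import Data.Empty using (⊥-elim)
open import Function using (_∘_; case_of_)
open import Function.Bundles using (_⇔_; mk⇔; Equivalence)
open import Relation.Nullary using (¬_; Dec; yes; no; contradiction)
open import Relation.Nullary.Decidable using (does; ¬?; _×-dec_; _⊎-dec_; decidable-stable; dec-true; dec-false)
open import Relation.Binary.Definitions using (tri<; tri≈; tri>)
open import Relation.Binary.PropositionalEquality
  using (_≡_; refl; sym; trans; cong; cong₂; subst; module ≡-Reasoning)

-- Automaton runs on convolutions of unary words.

<ᵇ-true : ∀ {m n} → m < n → (m <ᵇ n) ≡ true
<ᵇ-true m<n = Equivalence.to T-≡ (<⇒<ᵇ m<n)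

<ᵇ-true⁻ : ∀ {m n} → (m <ᵇ n) ≡ true → m < n
<ᵇ-true⁻ {m} {n} eq = <ᵇ⇒< m n (Equivalence.from T-≡ eq)

<ᵇ-false : ∀ {m n} → n ≤ m → (m <ᵇ n) ≡ false
<ᵇ-false n≤m = ¬-not (λ eq → <⇒≱ (<ᵇ-true⁻ eq) n≤m)

lookup≤maxV : ∀ {r} (ns : Vec ℕ r) j → lookup ns j ≤ maxV ns
lookup≤maxV (n ∷ ns) zero    = m≤m⊔n n (maxV ns)
lookup≤maxV (n ∷ ns) (suc j) = ≤-trans (lookup≤maxV ns j) (m≤n⊔m n (maxV ns))

maxV-lub : ∀ {r t} (ns : Vec ℕ r) → (∀ j → lookup ns j ≤ t) → maxV ns ≤ t
maxV-lub []       _  = z≤n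
maxV-lub (n ∷ ns) ≤t = ⊔-lub (≤t zero) (maxV-lub ns (≤t ∘ suc))

<maxV⇒<lookup : ∀ {r t} (ns : Vec ℕ r) → t < maxV ns → ∃ λ j → t < lookup ns j
<maxV⇒<lookup {t = t} (n ∷ ns) t<max with ⊔-sel n (maxV ns)
... | inj₁ eq = zero , subst (t <_) eq t<max
... | inj₂ eq with j , t<nⱼ ← <maxV⇒<lookup ns (subst (t <_) eq t<max) = suc j , t<nⱼ

letter : ∀ {r} → Vec ℕ r → ℕ → Letter r
letter ns t = tabulate (λ j → t <ᵇ lookup ns j)

-- Defined for every `t`, also past the end of the convolution, where all letters are padding.
-- Tuples with different maxima can thus be compared position by position.
stateAt : ∀ {r} (D : DFA r) → Vec ℕ r → ℕ → Fin (DFA.nStates D)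
stateAt D ns zero    = DFA.start D
stateAt D ns (suc t) = DFA.δ D (stateAt D ns t) (letter ns t)

run-letters : ∀ {r} (D : DFA r) ns t → run D (map (letter ns) (upTo t)) ≡ stateAt D ns t
run-letters D ns zero    = refl
run-letters D ns (suc t) = begin
  run D (map (letter ns) (upTo (suc t)))                ≡⟨ cong (run D ∘ map (letter ns)) (upTo-∷ʳ t) ⟨
  run D (map (letter ns) (upTo t List.∷ʳ t))            ≡⟨ cong (run D) (map-++ (letter ns) (upTo t) List.[ t ]) ⟩
  run D (map (letter ns) (upTo t) List.∷ʳ letter ns t)  ≡⟨ foldl-∷ʳ δ start (letter ns t) (map (letter ns) (upTo t)) ⟩
  δ (run D (map (letter ns) (upTo t))) (letter ns t)    ≡⟨ cong (λ q → δ q (letter ns t)) (run-letters D ns t) ⟩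
  δ (stateAt D ns t) (letter ns t)                      ∎
  where open ≡-Reasoning; open DFA D

run-conv : ∀ {r} (D : DFA r) ns → run D (conv ns) ≡ stateAt D ns (maxV ns)
run-conv D ns = run-letters D ns (maxV ns)

stateAt-cong : ∀ {r} (D : DFA r) {ms ns : Vec ℕ r} t →
               (∀ s → s < t → ∀ j → (s <ᵇ lookup ms j) ≡ (s <ᵇ lookup ns j)) →
               stateAt D ms t ≡ stateAt D ns t
stateAt-cong D zero    _  = refl
stateAt-cong D (suc t) eq =
  cong₂ (DFA.δ D) (stateAt-cong D t (λ s s<t → eq s (m<n⇒m<1+n s<t))) (tabulate-cong (eq t ≤-refl))

-- Guessing a tuple while reading a predicate from left to right.

Matches : ∀ {r} → (ℕ → Bool) → Vec Bool r → Vec ℕ r → Set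
Matches P pat ns = ∀ j → P (lookup ns j) ≡ lookup pat j

-- The tuples ns matching pat are guessed letter by letter.  After t letters, a
-- records which components are ≥ t; a component equal to t is dropped at
-- position t, and only if P t has the value pat prescribes for it.
module _ {r : ℕ} (D : DFA r) (pat : Vec Bool r) where
  open DFA D

  Drops : Bool → Letter r → Letter r → Set
  Drops b a a′ = ∀ j → lookup a′ j ≡ lookup a j ⊎ (lookup a′ j ≡ false × b ≡ lookup pat j)

  -- The mask `a′` left after a position marks the components above it, so it is also the letter
  -- read there. Demanding a live component keeps the reading inside the convolution. The position
  -- enters only through the bit `b`, which makes pumping possible.
  Step : Bool → Fin nStates → Letter r → Fin nStates → Letter r → Set
  Step b q a q′ a′ = Drops b a a′ × (∃ λ j → lookup a′ j ≡ true) × q′ ≡ δ q a′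

  Reach : (ℕ → Bool) → ℕ → Fin nStates → Letter r → Set
  Reach P zero    q a = q ≡ start × a ≡ tabulate (λ _ → true)
  Reach P (suc t) q a = ∃₂ λ q₀ a₀ → Reach P t q₀ a₀ × Step (P t) q₀ a₀ q a

  Bad : (ℕ → Bool) → ℕ → Set
  Bad P t = ∃₂ λ q a → Reach P t q a × Drops (P t) a (replicate r false) × accept q ≡ true

  drops? : ∀ b a a′ → Dec (Drops b a a′)
  drops? b a a′ = all? λ j →
    (lookup a′ j Bool.≟ lookup a j) ⊎-dec ((lookup a′ j Bool.≟ false) ×-dec (b Bool.≟ lookup pat j))

  reach? : ∀ P t q a → Dec (Reach P t q a)
  reach? P zero    q a = (q Fin.≟ start) ×-dec ≡-dec Bool._≟_ a _
  -- A letter is a Boolean vector, that is, a subset of `Fin r`, so `anySubset?` searches all masks.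
  reach? P (suc t) q a = any? λ q₀ → anySubset? λ a₀ →
    reach? P t q₀ a₀ ×-dec
    drops? (P t) a₀ a ×-dec any? (λ j → lookup a j Bool.≟ true) ×-dec (q Fin.≟ δ q₀ a)

  bad? : ∀ P t → Dec (Bad P t)
  bad? P t = any? λ q → anySubset? λ a →
    reach? P t q a ×-dec drops? (P t) a (replicate r false) ×-dec (accept q Bool.≟ true)

  -- `t <ᵇ suc n` tests `t ≤ n`, so the mask marks the live components. At `suc t` it reduces to the
  -- letter at `t`, and `suc t ≤ maxV ns` supplies a component that is still alive.
  Reach-stateAt : ∀ {P ns} → Matches P pat ns → ∀ t → t ≤ maxV ns →
                  Reach P t (stateAt D ns t) (tabulate (λ j → t <ᵇ suc (lookup ns j)))
  Reach-stateAt m zero    _ = refl , refl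
  Reach-stateAt {P} {ns} m (suc t) t<max =
    _ , _ , Reach-stateAt {P} {ns} m t (<⇒≤ t<max) , drops , alive , refl
    where
    drops : Drops (P t) (tabulate (λ j → t <ᵇ suc (lookup ns j))) (letter ns t)
    drops j rewrite lookup∘tabulate (λ j → t <ᵇ lookup ns j) j
                  | lookup∘tabulate (λ j → t <ᵇ suc (lookup ns j)) j with <-cmp t (lookup ns j)
    ... | tri< t<n _ _ = inj₁ (trans (<ᵇ-true t<n) (sym (<ᵇ-true (m<n⇒m<1+n t<n))))
    ... | tri≈ _ t≡n _ = inj₂ (<ᵇ-false (≤-reflexive (sym t≡n)) , trans (cong P t≡n) (m j))
    ... | tri> _ _ n<t = inj₁ (trans (<ᵇ-false (<⇒≤ n<t)) (sym (<ᵇ-false n<t)))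
    alive : ∃ λ j → lookup (letter ns t) j ≡ true
    alive with j , t<n ← <maxV⇒<lookup ns t<max = j , trans (lookup∘tabulate _ j) (<ᵇ-true t<n)

  match⇒Bad : ∀ {P} ns → Matches P pat ns → Accepts D (conv ns) → Bad P (maxV ns)
  match⇒Bad {P} ns m acc =
    _ , _ , Reach-stateAt {P} {ns} m (maxV ns) ≤-refl , drops ,
    trans (cong accept (sym (run-conv D ns))) acc
    where
    drops : Drops (P (maxV ns)) (tabulate (λ j → maxV ns <ᵇ suc (lookup ns j))) (replicate r false)
    drops j rewrite lookup-replicate j false
                  | lookup∘tabulate (λ j → maxV ns <ᵇ suc (lookup ns j)) j
      with m≤n⇒m<n∨m≡n (lookup≤maxV ns j)
    ... | inj₁ n<max = inj₁ (sym (<ᵇ-false n<max))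
    ... | inj₂ n≡max = inj₂ (refl , trans (cong P (sym n≡max)) (m j))

  -- Live components provisionally get the value `t`; how far they extend beyond `t` does not affect
  -- the first `t` letters.
  record Trace (P : ℕ → Bool) (t : ℕ) (q : Fin nStates) (a : Letter r) : Set where
    field
      tuple   : Vec ℕ r
      state   : stateAt D tuple t ≡ q
      maximum : maxV tuple ≡ t
      entry   : ∀ j → (lookup a j ≡ true × lookup tuple j ≡ t)
                    ⊎ (lookup a j ≡ false × lookup tuple j < t × P (lookup tuple j) ≡ lookup pat j)

  Reach⇒Trace : ∀ P t {q a} → Reach P t q a → Trace P t q a
  Reach⇒Trace P zero (refl , refl) = record
    { tuple   = replicate r 0
    ; state   = refl
    ; maximum = n≤0⇒n≡0 (maxV-lub (replicate r 0) (λ j → ≤-reflexive (lookup-replicate j 0)))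
    ; entry   = λ j → inj₁ (lookup∘tabulate _ j , lookup-replicate j 0)
    }
  Reach⇒Trace P (suc t) {a = a} (q₀ , a₀ , reach , drops , (k , aₖ) , refl) = record
    { tuple   = ns
    ; state   = cong₂ δ (trans (stateAt-cong D t agree) state) letter-t
    -- The live component demanded by `Step` attains `suc t`.
    ; maximum = ≤-antisym (maxV-lub ns ns≤1+t) (≤-trans (≤-reflexive (sym (now k aₖ))) (lookup≤maxV ns k))
    ; entry   = entry-suc
    }
    where
    open Trace (Reach⇒Trace P t reach)
    -- Components that stay alive move from `t` to `suc t`, which changes no comparison below `t`; a
    -- component dropped here keeps the value `t`.
    ns : Vec ℕ r
    ns = tabulate (λ j → if lookup a j then suc t else lookup tuple j)
    now : ∀ j → lookup a j ≡ true → lookup ns j ≡ suc t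
    now j eq = trans (lookup∘tabulate _ j) (cong (if_then suc t else lookup tuple j) eq)
    before : ∀ j → lookup a j ≡ false → lookup ns j ≡ lookup tuple j
    before j eq = trans (lookup∘tabulate _ j) (cong (if_then suc t else lookup tuple j) eq)
    tuple≤t : ∀ j → lookup tuple j ≤ t
    tuple≤t j = subst (lookup tuple j ≤_) maximum (lookup≤maxV tuple j)
    entry-suc : ∀ j → (lookup a j ≡ true × lookup ns j ≡ suc t)
                    ⊎ (lookup a j ≡ false × lookup ns j < suc t × P (lookup ns j) ≡ lookup pat j)
    entry-suc j with lookup a j in aⱼ
    ... | true  = inj₁ (refl , now j aⱼ)
    ... | false rewrite before j aⱼ = inj₂ (refl , s≤s (tuple≤t j) , value)
      where
      value : P (lookup tuple j) ≡ lookup pat j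
      value with entry j | drops j
      ... | inj₂ (_ , _ , p)   | _              = p
      ... | inj₁ (_ , n≡t)     | inj₂ (_ , p)   = trans (cong P n≡t) p
      ... | inj₁ (a₀ⱼ , _)     | inj₁ eq        = case trans (sym aⱼ) (trans eq a₀ⱼ) of λ ()
    ns≤1+t : ∀ j → lookup ns j ≤ suc t
    ns≤1+t j with entry-suc j
    ... | inj₁ (_ , eq)     = ≤-reflexive eq
    ... | inj₂ (_ , lt , _) = <⇒≤ lt
    agree : ∀ s → s < t → ∀ j → (s <ᵇ lookup ns j) ≡ (s <ᵇ lookup tuple j)
    agree s s<t j with lookup a j in aⱼ
    ... | false = cong (s <ᵇ_) (before j aⱼ)
    ... | true  with entry j | drops j
    ...   | inj₁ (_ , n≡t)   | _             =
      trans (<ᵇ-true (subst (s <_) (sym (now j aⱼ)) (m<n⇒m<1+n s<t)))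
            (sym (<ᵇ-true (subst (s <_) (sym n≡t) s<t)))
    ...   | inj₂ (a₀ⱼ , _)   | inj₁ eq       = case trans (sym aⱼ) (trans eq a₀ⱼ) of λ ()
    ...   | inj₂ _           | inj₂ (eq , _) = case trans (sym aⱼ) eq of λ ()
    bit : ∀ j → (t <ᵇ lookup ns j) ≡ lookup a j
    bit j with lookup a j in aⱼ
    ... | true  = <ᵇ-true (≤-reflexive (sym (now j aⱼ)))
    ... | false = <ᵇ-false (subst (_≤ t) (sym (before j aⱼ)) (tuple≤t j))
    letter-t : letter ns t ≡ a
    letter-t = trans (tabulate-cong bit) (tabulate∘lookup a)

  Bad⇒match : ∀ {P t} → Bad P t → ∃ λ ns → maxV ns ≡ t × Matches P pat ns × Accepts D (conv ns)
  Bad⇒match {P} {t} (q , a , reach , drops , acc) = tuple , maximum , matches , accepted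
    where
    open Trace (Reach⇒Trace P t reach)
    matches : Matches P pat tuple
    matches j with entry j | drops j
    ... | inj₂ (_ , _ , p) | _            = p
    ... | inj₁ (_ , n≡t)   | inj₂ (_ , p) = trans (cong P n≡t) p
    ... | inj₁ (aⱼ , _)    | inj₁ eq      = case trans (sym (lookup-replicate j false)) (trans eq aⱼ) of λ ()
    accepted : Accepts D (conv tuple)
    accepted = begin
      accept (run D (conv tuple))            ≡⟨ cong accept (run-conv D tuple) ⟩
      accept (stateAt D tuple (maxV tuple))  ≡⟨ cong (accept ∘ stateAt D tuple) maximum ⟩
      accept (stateAt D tuple t)             ≡⟨ cong accept state ⟩
      accept q                               ≡⟨ acc ⟩
      true                                   ∎
      where open ≡-Reasoning

-- Splitting off the last component, listing letters, coding decisions as bits.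

lookup-∷ʳ⁻ : ∀ {A B : Set} {n} (R : A → B → Set) (xs : Vec A n) {x} (ys : Vec B n) {y} →
             (∀ j → R (lookup (xs ∷ʳ x) j) (lookup (ys ∷ʳ y) j)) →
             (∀ j → R (lookup xs j) (lookup ys j)) × R x y
lookup-∷ʳ⁻ R []       []       rs = (λ ()) , rs zero
lookup-∷ʳ⁻ R (x ∷ xs) (y ∷ ys) rs with inits , last ← lookup-∷ʳ⁻ R xs ys (rs ∘ suc) =
  (λ { zero → rs zero ; (suc j) → inits j }) , last

lookup-∷ʳ⁺ : ∀ {A B : Set} {n} (R : A → B → Set) (xs : Vec A n) {x} (ys : Vec B n) {y} →
             (∀ j → R (lookup xs j) (lookup ys j)) → R x y →
             ∀ j → R (lookup (xs ∷ʳ x) j) (lookup (ys ∷ʳ y) j)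
lookup-∷ʳ⁺ R []       []       _     last zero    = last
lookup-∷ʳ⁺ R (x ∷ xs) (y ∷ ys) inits last zero    = inits zero
lookup-∷ʳ⁺ R (x ∷ xs) (y ∷ ys) inits last (suc j) = lookup-∷ʳ⁺ R xs ys (inits ∘ suc) last j

letters : ∀ r → List (Letter r)
letters zero    = [] ∷ []
letters (suc r) = map (true ∷_) (letters r) ++ map (false ∷_) (letters r)

∈-letters : ∀ {r} (a : Letter r) → a ∈ letters r
∈-letters []          = here refl
∈-letters (true  ∷ a) = ∈-++⁺ˡ (∈-map⁺ _ (∈-letters a))
∈-letters (false ∷ a) = ∈-++⁺ʳ _ (∈-map⁺ _ (∈-letters a))

decBit : ∀ {A : Set} → Dec A → Fin 2
decBit (yes _) = suc zero
decBit (no _)  = zero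

decBit-transfer : ∀ {A B : Set} (A? : Dec A) (B? : Dec B) → decBit A? ≡ decBit B? → A → B
decBit-transfer _       (yes b) _ _ = b
decBit-transfer (no ¬a) (no _)  _ a = contradiction a ¬a

-- Eventually periodic walks.

wrap : (s t : ℕ) → ℕ → ℕ
wrap s t n with n ≟ t
... | yes _ = s
... | no _  = n

-- The eventually periodic walk 0, 1, …, t-1, s, s+1, …, t-1, s, ….
lasso : (s t : ℕ) → ℕ → ℕ
lasso s t zero    = 0
lasso s t (suc n) = wrap s t (suc (lasso s t n))

lasso<t : ∀ {s t} → s < t → ∀ n → lasso s t n < t
lasso<t s<t zero = ≤-<-trans z≤n s<t
lasso<t {s} {t} s<t (suc n) with suc (lasso s t n) ≟ t
... | yes _ = s<t
... | no ≢t = ≤∧≢⇒< (lasso<t s<t n) ≢t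

lasso-id : ∀ {s t} n → n < t → lasso s t n ≡ n
lasso-id zero _ = refl
lasso-id {s} {t} (suc n) n<t rewrite lasso-id {s} {t} n (<⇒≤ n<t) with suc n ≟ t
... | yes refl = contradiction n<t (<-irrefl refl)
... | no _     = refl

-- Closure under automatic Horn rules.

module Closure {m : ℕ} {ar : Fin m → ℕ} (D : (i : Fin m) → DFA (suc (ar i))) where

  data Derivable (X : List ℕ) : ℕ → Set where
    base : ∀ {n} → n ∈ X → Derivable X n
    rule : ∀ i us {v} → (∀ j → Derivable X (lookup us j)) → Accepts (D i) (conv (us ∷ʳ v)) → Derivable X v

  -- Premises inside the predicate, conclusion outside: an accepted tuple with this pattern is a
  -- violated rule instance.
  violation : ∀ i → Vec Bool (suc (ar i))
  violation i = replicate (ar i) true ∷ʳ false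

  BadAt : (ℕ → Bool) → ℕ → Set
  BadAt P t = ∃ λ i → Bad (D i) (violation i) P t

  badAt? : ∀ P t → Dec (BadAt P t)
  badAt? P t = any? λ i → bad? (D i) (violation i) P t

  -- The tuple read off from `Bad` has maximum `t`, whence the bounds, which saturation uses to keep
  -- premises below its limit.
  BadAt⇒violation : ∀ {P t} → BadAt P t →
    ∃ λ i → ∃₂ λ us v → (∀ j → lookup us j ≤ t) × v ≤ t × (∀ j → P (lookup us j) ≡ true) × P v ≡ false ×
                        Accepts (D i) (conv (us ∷ʳ v))
  BadAt⇒violation {P} {t} (i , bad) with Bad⇒match (D i) (violation i) bad
  ... | ns , refl , m , acc with initLast ns
  ... | us , v , refl
    with us-ok , v≤t , v∉P ← lookup-∷ʳ⁻ (λ n b → n ≤ t × P n ≡ b) us (replicate (ar i) true) (λ j → lookup≤maxV ns j , m j) =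
    i , us , v , proj₁ ∘ us-ok , v≤t , (λ j → trans (proj₂ (us-ok j)) (lookup-replicate j true)) , v∉P , acc

  -- Induction on the derivation: a rule leading out of `P` would be bad at the maximum of its
  -- tuple.
  ¬BadAt⇒closed : ∀ {P} X → (∀ t → ¬ BadAt P t) → (∀ {x} → x ∈ X → P x ≡ true) →
                  ∀ {n} → Derivable X n → P n ≡ true
  ¬BadAt⇒closed X good X⊆P (base n∈X) = X⊆P n∈X
  ¬BadAt⇒closed {P} X good X⊆P (rule i us {v} ds acc) with P v in Pv
  ... | true  = refl
  ... | false = ⊥-elim (good _ (i , match⇒Bad (D i) (violation i) (us ∷ʳ v) matches acc))
    where
    matches : Matches P (violation i) (us ∷ʳ v)
    matches = lookup-∷ʳ⁺ (λ n b → P n ≡ b) us (replicate (ar i) true)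
      (λ j → trans (¬BadAt⇒closed X good X⊆P (ds j)) (sym (lookup-replicate j true))) Pv

  -- Coding the set of reachable configurations.

  Config : Set
  Config = Σ (Fin m) λ i → Fin (DFA.nStates (D i)) × Letter (suc (ar i))

  configs : List Config
  configs = concatMap (λ i → map (i ,_) (cartesianProduct (allFin _) (letters _))) (allFin m)

  ∈-configs : ∀ c → c ∈ configs
  ∈-configs (i , q , a) = ∈-concatMap⁺ _
    (lose (∈-allFin i) (∈-map⁺ (i ,_) (∈-cartesianProduct⁺ (∈-allFin q) (∈-letters a))))

  ReachC : (ℕ → Bool) → ℕ → Config → Set
  ReachC P t (i , q , a) = Reach (D i) (violation i) P t q a

  reachC? : ∀ P t c → Dec (ReachC P t c)
  reachC? P t (i , q , a) = reach? (D i) (violation i) P t q a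

  numCodes : ℕ
  numCodes = 2 ^ length configs

  -- The characteristic function of the reachable set, packed into one number so that the pigeonhole
  -- principle applies.
  code : (ℕ → Bool) → ℕ → Fin numCodes
  code P t = funToFin (λ k → decBit (reachC? P t (List.lookup configs k)))

  code-transfer : ∀ P s t → code P s ≡ code P t → ∀ c → ReachC P s c → ReachC P t c
  code-transfer P s t eq c = subst (λ c → ReachC P s c → ReachC P t c) (sym (Any.lookup-index c∈))
    (decBit-transfer (reachC? P s _) (reachC? P t _)
      (trans (sym (finToFun-funToFin _ k)) (trans (cong (λ f → finToFun f k) eq) (finToFun-funToFin _ k))))
    where
    c∈ = ∈-configs c
    k  = index c∈

  -- Pumping a predicate between two positions.

  module Pump {P : ℕ → Bool} {s t : ℕ} (s<t : s < t)
              (back : ∀ c → ReachC P t c → ReachC P s c)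
              (good : ∀ n → n < t → ¬ BadAt P n) where

    pumped : ℕ → Bool
    pumped = P ∘ lasso s t

    -- `pumped` at `n` is the bit of `P` at `lasso s t n`, so each step is also a step for `P`; when
    -- the walk would arrive at `t`, `back` moves the configuration to `s`.
    reach-lasso : ∀ n c → ReachC pumped n c → ReachC P (lasso s t n) c
    reach-lasso zero    c r = r
    reach-lasso (suc n) c@(i , q , a) (q₀ , a₀ , r , step)
      with suc (lasso s t n) ≟ t | q₀ , a₀ , reach-lasso n (i , q₀ , a₀) r , step
    ... | yes 1+n≡t | next = back c (subst (λ n → ReachC P n c) 1+n≡t next)
    ... | no _      | next = next

    ¬BadAt-pumped : ∀ n → ¬ BadAt pumped n
    ¬BadAt-pumped n (i , q , a , r , rest) =
      good (lasso s t n) (lasso<t s<t n) (i , q , a , reach-lasso n (i , q , a) r , rest)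

  pump : ∀ {P} n₀ → (∀ n → n < n₀ + suc numCodes → ¬ BadAt P n) →
         ∃ λ Q → (∀ n → ¬ BadAt Q n) × (∀ n → n < n₀ → Q n ≡ P n)
  pump {P} n₀ good with pigeonhole ≤-refl (λ (k : Fin (suc numCodes)) → code P (n₀ + toℕ k))
  -- Both positions are at least `n₀`, and the lasso is the identity below the later one, so the
  -- bits below `n₀` are kept.
  ... | k , l , k<l , eq = pumped , ¬BadAt-pumped , λ n n<n₀ → cong P (lasso-id n (≤-trans n<n₀ (m≤m+n n₀ (toℕ l))))
    where
    open Pump {P} (+-monoʳ-< n₀ k<l) (code-transfer P _ _ (sym eq))
              (λ n n<t → good n (<-trans n<t (+-monoʳ-< n₀ (toℕ<n l))))

  -- Saturation below a bound, and the decision.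

  -- A finite list of exclusions suffices: badness at `t` reads the predicate only up to `t`.
  outside : List ℕ → ℕ → Bool
  outside out n = not (does (n ∈? out))

  outside-true : ∀ {out n} → n ∉ out → outside out n ≡ true
  outside-true {out} {n} n∉ = cong not (dec-false (n ∈? out) n∉)

  outside-true⁻ : ∀ {out n} → outside out n ≡ true → n ∉ out
  outside-true⁻ {out} {n} eq with n ∈? out
  ... | no n∉ = n∉

  outside-false : ∀ {out n} → n ∈ out → outside out n ≡ false
  outside-false {out} {n} n∈ = cong not (dec-true (n ∈? out) n∈)

  outside-false⁻ : ∀ {out n} → outside out n ≡ false → n ∈ out
  outside-false⁻ {out} {n} eq with n ∈? out
  ... | yes n∈ = n∈

  record Saturated (X : List ℕ) (B : ℕ) : Set where
    field
      out      : List ℕ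
      sound    : ∀ n → n < B → n ∉ out → Derivable X n
      disjoint : ∀ {x} → x ∈ X → x ∉ out
      good     : ∀ t → t < B → ¬ BadAt (outside out) t

  -- A violation found below `B` has derivable premises, so its conclusion `v` is derivable and may
  -- leave `out`. Since `v` was in `out`, the list gets strictly shorter and the fuel suffices.
  saturate : ∀ X B fuel out → length out < fuel →
             (∀ n → n < B → n ∉ out → Derivable X n) → (∀ {x} → x ∈ X → x ∉ out) → Saturated X B
  saturate X B (suc fuel) out len sound disjoint with any? (λ (k : Fin B) → badAt? (outside out) (toℕ k))
  ... | no ¬bad = record
    { out = out ; sound = sound ; disjoint = disjoint
    ; good = λ t t<B bad → ¬bad (fromℕ< t<B , subst (BadAt (outside out)) (sym (toℕ-fromℕ< t<B)) bad) }
  ... | yes (k , bad) with i , us , v , us≤ , v≤ , us-in , v-out , acc ← BadAt⇒violation {outside out} bad =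
    saturate X B fuel (filter (¬? ∘ (_≟ v)) out)
      (≤-trans (filter-notAll (¬? ∘ (_≟ v)) out (Any.map (λ v≡n n≢v → n≢v (sym v≡n)) (outside-false⁻ {out} v-out)))
               (s≤s⁻¹ len))
      sound′ (λ x∈X x∈out → disjoint x∈X (proj₁ (∈-filter⁻ (¬? ∘ (_≟ v)) x∈out)))
    where
    sound′ : ∀ n → n < B → n ∉ filter (¬? ∘ (_≟ v)) out → Derivable X n
    sound′ n n<B n∉ with n ≟ v
    ... | no n≢v   = sound n n<B (λ n∈ → n∉ (∈-filter⁺ (¬? ∘ (_≟ v)) n∈ n≢v))
    ... | yes refl = rule i us
      (λ j → sound _ (≤-<-trans (us≤ j) (toℕ<n k)) (outside-true⁻ {out} (us-in j))) acc

  Saturated⇒Dec : ∀ {X w} n₀ → w < n₀ → (∀ {x} → x ∈ X → x < n₀) →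
                  Saturated X (n₀ + suc numCodes) → Dec (Derivable X w)
  Saturated⇒Dec {X} {w} n₀ w<n₀ X<n₀ record { out = out ; sound = sound ; disjoint = disjoint ; good = good }
    with w ∈? out
  ... | no w∉ = yes (sound w (≤-trans w<n₀ (m≤m+n n₀ _)) w∉)
  -- `Q` agrees with the saturated predicate below `n₀`, so it contains `X` and omits `w`; being
  -- closed, it excludes any derivation of `w`.
  ... | yes w∈ with Q , ¬bad , agree ← pump {outside out} n₀ good = no λ d →
    case trans (sym (¬BadAt⇒closed X ¬bad X⊆Q d)) (trans (agree w w<n₀) (outside-false {out} w∈)) of λ ()
    where
    X⊆Q : ∀ {x} → x ∈ X → Q x ≡ true
    X⊆Q {x} x∈X = trans (agree x (X<n₀ x∈X)) (outside-true {out} (disjoint x∈X))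

  derivable? : ∀ X w → Dec (Derivable X w)
  derivable? X w = Saturated⇒Dec n₀ (s≤s (⊥≤max w X)) (λ x∈X → s≤s (All.lookup (xs≤max w X) x∈X))
    -- Initially everything below `B` outside `X` is excluded; `≤-refl` fixes the fuel at one more
    -- than the length of that list.
    (saturate X B _ candidates ≤-refl
      (λ n n<B n∉ → base (decidable-stable (n ∈? X) (n∉ ∘ ∈-filter⁺ (¬? ∘ (_∈? X)) (∈-upTo⁺ n<B))))
      (λ x∈X x∈ → proj₂ (∈-filter⁻ (¬? ∘ (_∈? X)) {xs = upTo B} x∈) x∈X))
    where
    n₀ B : ℕ
    n₀ = suc (max w X)
    B  = n₀ + suc numCodes
    candidates : List ℕ
    candidates = filter (¬? ∘ (_∈? X)) (upTo B)

-- Generated subalgebras as Horn closures.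

module _ {m : ℕ} {ar : Fin m → ℕ} (Deq : DFA 2) (Dop : (i : Fin m) → DFA (suc (ar i))) where

  -- Index `zero` is equality, read as a rule with one premise: a word equal in the algebra to a
  -- derivable word is derivable.
  ruleArity : Fin (suc m) → ℕ
  ruleArity zero    = 1
  ruleArity (suc i) = ar i

  rules : (i : Fin (suc m)) → DFA (suc (ruleArity i))
  rules zero    = Deq
  rules (suc i) = Dop i

  open Closure rules

  module _ {S : Algebra m ar} {φ : ℕ → Algebra.Carrier S}
           (pres : IsUnaryFAPresentation S φ Deq Dop) (X : List ℕ) where
    open IsUnaryFAPresentation pres
    open Algebra S

    Derivable⇒Generated : ∀ {n} → Derivable X n → Generated S (Image S φ X) (φ n)
    Derivable⇒Generated (base n∈X) = gen (Any.map (λ n≡x → cong φ (sym n≡x)) n∈X)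
    Derivable⇒Generated (rule zero (u ∷ []) {v} ds acc) =
      subst (Generated S _) (proj₁ (eqCorrect u v) acc) (Derivable⇒Generated (ds zero))
    Derivable⇒Generated (rule (suc i) us {v} ds acc) =
      subst (Generated S _) (proj₁ (opCorrect i us v) acc)
        (app i (Vec.map φ us) λ j → subst (Generated S _) (sym (lookup-map j φ us)) (Derivable⇒Generated (ds j)))

    preimages : ∀ {k} (xs : Vec Carrier k) → ∃ λ us → Vec.map φ us ≡ xs
    preimages []       = [] , refl
    preimages (x ∷ xs) with u , refl ← surjective x | us , refl ← preimages xs = u ∷ us , refl

    -- Quantifying over every word `n` that denotes `s` lets the induction use whichever preimages
    -- surjectivity picks. For a generator, the equality rule leads from the word in `X` to `n`.
    Generated⇒Derivable : ∀ {s} → Generated S (Image S φ X) s → ∀ n → φ n ≡ s → Derivable X n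
    Generated⇒Derivable (gen s∈) n φn≡s with x , x∈X , φx≡s ← find s∈ =
      rule zero (x ∷ []) (λ { zero → base x∈X }) (proj₂ (eqCorrect x n) (trans φx≡s (sym φn≡s)))
    Generated⇒Derivable (app i xs gs) n φn≡s with us , refl ← preimages xs =
      rule (suc i) us (λ j → Generated⇒Derivable (gs j) (lookup us j) (sym (lookup-map j φ us)))
        (proj₂ (opCorrect i us n) (sym φn≡s))

theorem5p3 : Σ ((m : ℕ) (ar : Fin m → ℕ) → DFA 2 → ((i : Fin m) → DFA (suc (ar i))) → List ℕ → ℕ → Bool)
    λ decide → ∀ (m : ℕ) (ar : Fin m → ℕ) (S : Algebra m ar) (φ : ℕ → Algebra.Carrier S)
    (Deq : DFA 2) (Dop : (i : Fin m) → DFA (suc (ar i))) →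
    IsUnaryFAPresentation S φ Deq Dop →
    (X : List ℕ) (w : ℕ) →
    (decide m ar Deq Dop X w ≡ true) ⇔ Generated S (Image S φ X) (φ w)
theorem5p3 =
  -- Derivability refers only to the automata and `X`, so it is decided without access to `S` or
  -- `φ`; the presentation enters through the correctness proof.
  (λ m ar Deq Dop X w → does (Closure.derivable? (rules Deq Dop) X w)) ,
  λ m ar S φ Deq Dop pres X w → let d = Closure.derivable? (rules Deq Dop) X w in
    mk⇔ (λ eq → Derivable⇒Generated Deq Dop pres X (toDerivable d eq))
        (λ g → dec-true d (Generated⇒Derivable Deq Dop pres X g w refl))
  where
  toDerivable : ∀ {A : Set} (d : Dec A) → does d ≡ true → A
  toDerivable (yes a) _ = a
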